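{- There exist a real $\alpha>0$ and an $n_0\in\mathbb{N}$ such that for every even $n\ge n_0$ there is a directed $3$-regular graph $G$ on $6n$ vertices (that is, the sum of the in-degree and the out-degree of every vertex of $G$ is $3$) such that $\alpha n$ cops do not suffice to catch the robber on $G$, i.e. $\mathrm{ent}(G)>\alpha n$.
   Context: Entanglement game on a finite directed graph $G$ with $k$ cops: First the robber chooses a starting vertex, and all $k$ cops are outside the graph. In every turn, the cops either all stay where they are, or exactly one of them flies (from wherever it is, on or off the graph) to the current position of the robber. Regardless of which of these happened, the robber then has to move to a successor (out-neighbor) of his current position that is not occupied by a cop. If there is no such successor, the cops win. The robber wins if he can run away indefinitely. Both sides have full information. The entanglement number $\mathrm{ent}(G)$ is the minimal integer $k$ such that $k$ cops have a strategy to catch the robber on $G$. "$\alpha n$ cops do not suffice" means that no integer number $k\le\alpha n$ of cops can catch the robber, i.e. $\mathrm{ent}(G)>\alpha n$. Directed graphs have no loops and no parallel arcs. -}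

module Defs where

open import Data.Fin using (Fin)
open import Data.Fin.Subset using (Subset; _∈_; _∉_; ∣_∣)
open import Data.List using (List; applyUpTo)
open import Data.Maybe using (Maybe; just; nothing)
open import Data.Nat using (ℕ; zero; suc; _+_)
open import Data.Product using (∃-syntax; _×_)
open import Data.Vec using (Vec; lookup; replicate; tabulate; _[_]≔_)
import Data.Vec.Membership.Propositional as Vec
open import Relation.Binary.PropositionalEquality using (_≡_)
open import Relation.Nullary using (¬_)

-- Antiparallel arcs u → v and v → u are allowed.
record Digraph (m : ℕ) : Set where
  field
    outNeighbours : Fin m → Subset m
    noLoops       : ∀ v → v ∉ outNeighbours v

  infix 4 _⟶_
  _⟶_ : Fin m → Fin m → Set
  u ⟶ v = v ∈ outNeighbours u

  inNeighbours : Fin m → Subset m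
  inNeighbours v = tabulate λ u → lookup (outNeighbours u) v

  outDegree : Fin m → ℕ
  outDegree v = ∣ outNeighbours v ∣

  inDegree : Fin m → ℕ
  inDegree v = ∣ inNeighbours v ∣

Regular : ∀ {m} → ℕ → Digraph m → Set
Regular d G = ∀ v → inDegree v + outDegree v ≡ d
  where open Digraph G

-- A cop at `nothing` is outside the graph.
CopPositions : ℕ → ℕ → Set
CopPositions m k = Vec (Maybe (Fin m)) k

-- `nothing`: all cops stay; `just i`: cop i flies to the robber.
CopMove : ℕ → Set
CopMove k = Maybe (Fin k)

moveCops : ∀ {m k} → CopMove k → Fin m → CopPositions m k → CopPositions m k
moveCops nothing  r c = c
moveCops (just i) r c = c [ i ]≔ just r

-- The argument lists all robber positions so far, starting vertex first.
-- Together with the strategy itself it determines all earlier cop moves,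
-- so it carries the full history of the play.
CopStrategy : ℕ → ℕ → Set
CopStrategy m k = List (Fin m) → CopMove k

-- Cop positions after t turns when the robber's successive positions are
-- ρ 0, ρ 1, ….
copsAt : ∀ {m k} → CopStrategy m k → (ℕ → Fin m) → ℕ → CopPositions m k
copsAt {k = k} σ ρ zero = replicate k nothing
copsAt σ ρ (suc t) = moveCops (σ (applyUpTo ρ (suc t))) (ρ t) (copsAt σ ρ t)

-- The robber's infinite run ρ is legal against σ.
EvadesForever : ∀ {m k} → Digraph m → CopStrategy m k → (ℕ → Fin m) → Set
EvadesForever G σ ρ =
  ∀ t → (ρ t ⟶ ρ (suc t)) × just (ρ (suc t)) Vec.∉ copsAt σ ρ (suc t)
  where open Digraph G

-- The robber loses exactly when he gets stuck, so σ is winning iff no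
-- infinite run is legal against it.  The entanglement number of G is the
-- least k with CopsCatch G k.
CopsCatch : ∀ {m} → Digraph m → ℕ → Set
CopsCatch {m} G k = ∃[ σ ] (∀ ρ → ¬ EvadesForever {m} {k} G σ ρ)

{-# OPTIONS --safe #-}
module Submission where

-- Group 20 slots into each of M = 4 s hubs and join the slots by a permutation
-- such that any s hubs have an arc to any s hubs; counting permutations shows
-- that one exists.  Each slot is replaced by four vertices of degree 3 and each
-- hub is made strongly connected.  For k < s / 3 cops, a set S of vertices
-- closed under arcs to unoccupied vertices then meets either at most s + k hubs
-- or all but s + k of them.  Small closed sets are closed under union, so there
-- is a largest one, and the robber always has a move that keeps him outside it.

open import Data.Bool using (true; false; if_then_else_; _∧_)
import Data.Empty as Empty
open import Data.Fin as Fin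
  using (Fin; zero; suc; combine; remQuot; quotient; splitAt; fromℕ; inject₁; punchIn; _↑ˡ_)
open import Data.Fin.Induction using (<-weakInduction; <-weakInduction-startingFrom)
open import Data.Fin.Patterns using (0F; 1F; 2F; 3F)
open import Data.Fin.Permutation as Perm
  using (Permutation; _⟨$⟩ʳ_; _⟨$⟩ˡ_; inverseˡ; inverseʳ; insert; insert-punchIn)
open import Data.Fin.Properties
  using (any?; all?; +↔⊎; *↔×; splitAt-↑ˡ; splitAt⁻¹-↑ˡ; remQuot-combine; combine-remQuot; ≤fromℕ)
open import Data.Fin.Subset using (Subset; _∈_; _∉_; _⊆_; ∣_∣; ∁; ⊥; ⊤; ⁅_⁆; _∪_; _─_)
open import Data.Fin.Subset.Properties
open import Data.List as List
  using (List; []; _∷_; _∷ʳ_; _++_; length; foldr; filter; cartesianProduct; allFin; applyUpTo)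
open import Data.List.Membership.Propositional using () renaming (_∈_ to _∈ₗ_; _∉_ to _∉ₗ_)
open import Data.List.Membership.Propositional.Properties
  using (∈-map⁺; ∈-map⁻; ∈-++⁺ˡ; ∈-++⁺ʳ; ∈-filter⁺; ∈-cartesianProduct⁺; ∈-allFin)
open import Data.List.Properties using (length-map; length-++; length-filter; applyUpTo-∷ʳ)
open import Data.List.Relation.Unary.All as All using (All; []; _∷_)
import Data.List.Relation.Unary.All.Properties as All
open import Data.List.Relation.Unary.AllPairs using ([]; _∷_)
open import Data.List.Relation.Unary.Any using (here; there)
open import Data.List.Relation.Unary.Unique.Propositional using (Unique)
open import Data.List.Relation.Unary.Unique.Propositional.Properties using (map⁺)
open import Data.Maybe using (Maybe; just; nothing)
open import Data.Maybe.Properties using (just-injective; ≡-dec)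
open import Data.Nat using (ℕ; _≥_) renaming (_*_ to _*ℕ_)
open import Data.Nat.Divisibility using (_∣_; divides)
open import Data.Nat.Tactic.RingSolver using (solve-∀)
open import Data.Product using (∃-syntax; _×_; _,_; proj₁; proj₂)
open import Data.Product.Function.NonDependent.Propositional using (_×-↔_)
open import Data.Sum using (_⊎_; inj₁; inj₂; [_,_]′)
open import Data.Sum.Function.Propositional using (_⊎-↔_)
open import Data.Vec as Vec using (Vec; []; _∷_; here; there; tabulate; lookup; removeAt; concat; replicate; _[_]≔_)
import Data.Vec.Membership.DecPropositional as DecVec
import Data.Vec.Membership.Propositional as Vec
open import Data.Vec.Properties
  using ([]=⇒lookup; lookup⇒[]=; lookup∘tabulate; lookup-concat; lookup-map; lookup-replicate)
import Data.Vec.Relation.Unary.Any as VecAny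
open import Function using (_∘_; const; _↔_; Inverse)
open import Function.Construct.Composition using (_↔-∘_)
open import Function.Construct.Identity using (↔-id)
open import Function.Construct.Symmetry using (↔-sym)
open import Relation.Binary.PropositionalEquality
open import Relation.Nullary using (¬_; Dec; yes; no; does; contradiction)
open import Relation.Nullary.Decidable using (_×-dec_; _→-dec_; ¬?; dec-true; decidable-stable)
open import Relation.Unary using (Decidable)
open import Defs

-- The constants come from three thresholds. A pair of sets of s out of 4 s hubs is missed by a
-- fraction of at most (3/4)^(20 s) of the permutations, and there are at most 4^(4 s) pairs; the
-- union bound succeeds because 4^4 (3/4)^20 < 1, and 20 is the least exponent for which this holds.
-- Strong connectivity of the hubs is what makes this coarse expansion usable: the arc it supplies
-- may start anywhere in a hub, but a closed set that meets a cop-free hub contains all of it. At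
-- most k hubs hold cops. Put q = s + k. Closed sets meet at most q or at least M - q hubs, and a
-- union of two small ones meets at most 2 q. This lies below M - q exactly when 3 q < M, which for
-- M = 4 s says 3 k < s. With 3 n / 2 slots, s is about 3 n / 160, which leaves room for about n /
-- 160 cops; half of that is given up for rounding, whence 1 / 320.

private variable m n k M : ℕ

-- Counting the permutations that miss a constraint

module Counting where

  open import Data.Nat
  open import Data.Nat.Properties
  open import Algebra.Properties.CommutativeMonoid.Sum +-0-commutativeMonoid
    using (sum; ∑-distrib-+; sum-cong-≗)

  sum-split : ∀ (Q : Subset n) {u w} (f : Fin n → ℕ) →
              (∀ j → f j ≡ (if lookup Q j then u else w)) → sum f ≡ ∣ Q ∣ * u + ∣ ∁ Q ∣ * w
  sum-split []          f f≗ = refl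
  sum-split (true ∷ Q) {u} f f≗ =
    trans (cong₂ _+_ (f≗ zero) (sum-split Q _ (λ j → f≗ (suc j)))) (sym (+-assoc u _ _))
  sum-split (false ∷ Q) {u} {w} f f≗ =
    trans (cong₂ _+_ (f≗ zero) (sum-split Q _ (λ j → f≗ (suc j)))) (swap w (∣ Q ∣ * u) (∣ ∁ Q ∣ * w))
    where
    swap : ∀ a b c → a + (b + c) ≡ b + (a + c)
    swap = solve-∀

  below-average : ∀ B (f : Fin n → ℕ) → sum f < n * B → ∃[ j ] f j < B
  below-average {suc n} B f lt with f zero <? B
  ... | yes f₀<B = zero , f₀<B
  ... | no  f₀≮B with below-average B (λ j → f (suc j))
                        (+-cancelˡ-< B _ _ (<-≤-trans (s≤s (+-monoˡ-≤ _ (≮⇒≥ f₀≮B))) lt))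
  ...   | j , fj<B = suc j , fj<B

  Constraint : ℕ → Set
  Constraint n = Subset n × Subset n

  Hits : Permutation n n → Constraint n → Set
  Hits π (P , Q) = ∃[ i ] i ∈ P × (π ⟨$⟩ʳ i) ∈ Q

  -- What the constraints still demand of a permutation that maps 0 to j.
  restrict : Fin (suc n) → List (Constraint (suc n)) → List (Constraint n)
  restrict j []                  = []
  restrict j ((p ∷ P , Q) ∷ cs) =
    if p ∧ lookup Q j then restrict j cs else (P , removeAt Q j) ∷ restrict j cs

  -- The number of pairs of a permutation and a constraint not hit by it.
  misses : List (Constraint n) → ℕ
  misses {zero}  cs = length cs
  misses {suc n} cs = sum (λ j → misses (restrict j cs))

  removeAt-∈ : ∀ (Q : Subset (suc n)) j {i} → i ∈ removeAt Q j → punchIn j i ∈ Q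
  removeAt-∈ (q ∷ Q)         zero    i∈         = there i∈
  removeAt-∈ (q ∷ Q@(_ ∷ _)) (suc j) here       = here
  removeAt-∈ (q ∷ Q@(_ ∷ _)) (suc j) (there i∈) = there (removeAt-∈ Q j i∈)

  hitting-insert : ∀ j (π : Permutation n n) cs →
                   All (Hits π) (restrict j cs) → All (Hits (insert zero j π)) cs
  hitting-insert j π []                     hs = []
  hitting-insert j π ((true ∷ P , Q) ∷ cs) hs with lookup Q j in eq
  ... | true = (zero , here , lookup⇒[]= j Q eq) ∷ hitting-insert j π cs hs
  hitting-insert j π ((true ∷ P , Q) ∷ cs) ((i , i∈P , πi∈Q) ∷ hs) | false =
    (suc i , there i∈P , subst (_∈ Q) (sym (insert-punchIn zero j π i)) (removeAt-∈ Q j πi∈Q))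
    ∷ hitting-insert j π cs hs
  hitting-insert j π ((false ∷ P , Q) ∷ cs) ((i , i∈P , πi∈Q) ∷ hs) =
    (suc i , there i∈P , subst (_∈ Q) (sym (insert-punchIn zero j π i)) (removeAt-∈ Q j πi∈Q))
    ∷ hitting-insert j π cs hs

  -- Conditional expectations: as `suc n !` is `suc n * n !`, fewer than `suc n !` misses in total
  -- leave an image `j` of 0 that keeps fewer than `n !`. At size 0 the bound is 1, so no constraint
  -- is left open.
  hitting-permutation : ∀ (cs : List (Constraint n)) → misses cs < n ! →
                        ∃[ π ] All (Hits {n} π) cs
  hitting-permutation {zero}  []       lt = Perm.id , []
  hitting-permutation {zero}  (_ ∷ _) (s≤s ())
  hitting-permutation {suc n} cs lt
    with j , lt′ ← below-average (n !) (λ j → misses (restrict j cs)) lt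
    with π , hs ← hitting-permutation (restrict j cs) lt′
    = insert zero j π , hitting-insert j π cs hs

  misses-[] : misses {n} [] ≡ 0
  misses-[] {zero}  = refl
  misses-[] {suc n} = sum-zero {suc n} (λ _ → misses-[] {n})
    where
    sum-zero : ∀ {m} {f : Fin m → ℕ} → (∀ j → f j ≡ 0) → sum f ≡ 0
    sum-zero {zero}  f≗0 = refl
    sum-zero {suc m} f≗0 = cong₂ _+_ (f≗0 zero) (sum-zero (λ j → f≗0 (suc j)))

  -- Since misses are counted with multiplicity, they are additive in the constraints. This is the
  -- union bound, and it reduces everything to a single constraint.
  misses-∷ : ∀ c (cs : List (Constraint n)) → misses (c ∷ cs) ≡ misses (c ∷ []) + misses cs
  misses-∷ {zero}  c cs = refl
  misses-∷ {suc n} c@(p ∷ P , Q) cs =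
    trans (sum-cong-≗ split) (∑-distrib-+ (λ j → misses (restrict j (c ∷ []))) (λ j → misses (restrict j cs)))
    where
    split : ∀ j → misses (restrict j (c ∷ cs)) ≡ misses (restrict j (c ∷ [])) + misses (restrict j cs)
    split j with p ∧ lookup Q j
    ... | true  = cong (_+ misses (restrict j cs)) (sym (misses-[] {n}))
    ... | false = misses-∷ (P , removeAt Q j) (restrict j cs)

  misses-≤ : ∀ K {B} (cs : List (Constraint n)) → All (λ c → K * misses (c ∷ []) ≤ B) cs →
             K * misses cs ≤ length cs * B
  misses-≤ {n}    K []       []       = ≤-reflexive (trans (cong (K *_) (misses-[] {n})) (*-zeroʳ K))
  misses-≤ K {B} (c ∷ cs) (b ∷ bs) = begin
    K * misses (c ∷ cs)                  ≡⟨ cong (K *_) (misses-∷ c cs) ⟩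
    K * (misses (c ∷ []) + misses cs)    ≡⟨ *-distribˡ-+ K (misses (c ∷ [])) (misses cs) ⟩
    K * misses (c ∷ []) + K * misses cs  ≤⟨ +-mono-≤ b (misses-≤ K cs bs) ⟩
    B + length cs * B                    ∎
    where open ≤-Reasoning

  infixl 8 _falling_
  -- The falling factorial y (y - 1) ... (y - a + 1), the number of injections from `a` points into
  -- `y` points; for `y < a` a factor is 0.
  _falling_ : ℕ → ℕ → ℕ
  y falling zero  = 1
  y falling suc a = y * (pred y falling a)

  falling-suc : ∀ y a → y falling suc a ≡ y falling a * (y ∸ a)
  falling-suc y       zero    = *-comm y 1
  falling-suc zero    (suc a) = refl
  falling-suc (suc y) (suc a) = trans (cong (suc y *_) (falling-suc y a)) (sym (*-assoc (suc y) (y falling a) (y ∸ a)))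

  falling-vanishes : ∀ {y a} → y < a → y falling a ≡ 0
  falling-vanishes {zero}  {suc a} _ = refl
  falling-vanishes {suc y} {suc a} (s≤s y<a) = trans (cong (suc y *_) (falling-vanishes y<a)) (*-zeroʳ (suc y))

  ∣∁-removeAt∣ : ∀ (Q : Subset (suc n)) j →
                 ∣ ∁ (removeAt Q j) ∣ ≡ (if lookup Q j then ∣ ∁ Q ∣ else pred ∣ ∁ Q ∣)
  ∣∁-removeAt∣ (true  ∷ Q) zero = refl
  ∣∁-removeAt∣ (false ∷ Q) zero = refl
  ∣∁-removeAt∣ (true  ∷ Q@(_ ∷ _)) (suc j) = ∣∁-removeAt∣ Q j
  ∣∁-removeAt∣ (false ∷ Q@(_ ∷ _)) (suc j) with lookup Q j in eq | ∣∁-removeAt∣ Q j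
  ... | true  | ih = cong suc ih
  ... | false | ih = trans (cong suc ih) (suc-pred ∣ ∁ Q ∣ {{>-nonZero (pos Q j eq)}})
    where
    pos : ∀ {n} (Q : Subset n) j → lookup Q j ≡ false → 0 < ∣ ∁ Q ∣
    pos (false ∷ Q) _       _  = s≤s z≤n
    pos (true  ∷ Q) (suc j) eq = pos Q j eq

  ∣p∣+∣∁p∣≡n : ∀ (P : Subset n) → ∣ P ∣ + ∣ ∁ P ∣ ≡ n
  ∣p∣+∣∁p∣≡n []          = refl
  ∣p∣+∣∁p∣≡n (true  ∷ P) = cong suc (∣p∣+∣∁p∣≡n P)
  ∣p∣+∣∁p∣≡n (false ∷ P) = trans (+-suc ∣ P ∣ _) (cong suc (∣p∣+∣∁p∣≡n P))

  -- A permutation misses the constraint when it sends `P` injectively into the complement of `Q`;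
  -- the points outside `P` then take the remaining places in any order.
  misses-single : ∀ (P Q : Subset n) → misses ((P , Q) ∷ []) ≡ ∣ ∁ Q ∣ falling ∣ P ∣ * ∣ ∁ P ∣ !
  misses-single [] [] = refl
  misses-single {suc n} (true ∷ P) Q = begin
    sum (λ j → misses (restrict j ((true ∷ P , Q) ∷ [])))  ≡⟨ sum-split Q _ each ⟩
    ∣ Q ∣ * 0 + y * (pred y falling a * z !)               ≡⟨ cong (_+ y * (pred y falling a * z !)) (*-zeroʳ ∣ Q ∣) ⟩
    y * (pred y falling a * z !)                           ≡⟨ *-assoc y (pred y falling a) (z !) ⟨
    y * (pred y falling a) * z !                           ∎
    where
    open ≡-Reasoning
    y = ∣ ∁ Q ∣
    a = ∣ P ∣
    z = ∣ ∁ P ∣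
    each : ∀ j → misses (restrict j ((true ∷ P , Q) ∷ [])) ≡ (if lookup Q j then 0 else pred y falling a * z !)
    each j with lookup Q j | ∣∁-removeAt∣ Q j
    ... | true  | _  = misses-[] {n}
    ... | false | eq = trans (misses-single P (removeAt Q j)) (cong (λ y → y falling a * z !) eq)
  misses-single {suc n} (false ∷ P) Q = begin
    sum (λ j → misses (restrict j ((false ∷ P , Q) ∷ [])))  ≡⟨ sum-split Q _ each ⟩
    b * (y falling a * z !) + y * (pred y falling a * z !)  ≡⟨ rearrange b (y falling a) (z !) y (pred y falling a) ⟩
    (b * y falling a + y falling suc a) * z !               ≡⟨ cong (_* z !) (cong (b * y falling a +_) (falling-suc y a)) ⟩
    (b * y falling a + y falling a * (y ∸ a)) * z !         ≡⟨ cong (_* z !) count ⟩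
    y falling a * suc z * z !                               ≡⟨ *-assoc (y falling a) (suc z) (z !) ⟩
    y falling a * (suc z * z !)                             ∎
    where
    open ≡-Reasoning
    b = ∣ Q ∣
    y = ∣ ∁ Q ∣
    a = ∣ P ∣
    z = ∣ ∁ P ∣
    rearrange : ∀ b f z y g → b * (f * z) + y * (g * z) ≡ (b * f + y * g) * z
    rearrange = solve-∀
    factor : ∀ b f d → b * f + f * d ≡ f * (b + d)
    factor = solve-∀
    each : ∀ j → misses (restrict j ((false ∷ P , Q) ∷ []))
               ≡ (if lookup Q j then y falling a * z ! else pred y falling a * z !)
    each j with lookup Q j | ∣∁-removeAt∣ Q j
    ... | true  | eq = trans (misses-single P (removeAt Q j)) (cong (λ y → y falling a * z !) eq)
    ... | false | eq = trans (misses-single P (removeAt Q j)) (cong (λ y → y falling a * z !) eq)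
    -- If the images of `P` are chosen before that of 0, then `b + (y - a) = suc z` places are left
    -- for 0. For `a > y` there is no injection and both sides vanish, so the truncated subtraction
    -- does no harm.
    count : b * y falling a + y falling a * (y ∸ a) ≡ y falling a * suc z
    count with a ≤? y
    ... | yes a≤y = trans (factor b (y falling a) (y ∸ a)) (cong (y falling a *_) (+-cancelʳ-≡ a _ _ (begin
      b + (y ∸ a) + a  ≡⟨ +-assoc b (y ∸ a) a ⟩
      b + (y ∸ a + a)  ≡⟨ cong (b +_) (m∸n+n≡m a≤y) ⟩
      b + y            ≡⟨ ∣p∣+∣∁p∣≡n Q ⟩
      suc n            ≡⟨ cong suc (∣p∣+∣∁p∣≡n P) ⟨
      suc (a + z)      ≡⟨ cong suc (+-comm a z) ⟩
      suc z + a        ∎)))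
    ... | no a≰y rewrite falling-vanishes (≰⇒> a≰y) = trans (+-identityʳ (b * 0)) (*-zeroʳ b)

  !-split : ∀ a z → (a + z) ! ≡ (a + z) falling a * z !
  !-split zero    z = sym (*-identityˡ (z !))
  !-split (suc a) z = trans (cong (suc (a + z) *_) (!-split a z)) (sym (*-assoc (suc (a + z)) ((a + z) falling a) (z !)))

  -- A factor y − i of y falling a is at most 3/4 of the factor n − i of n falling a.
  falling-ratio : ∀ {y n} a → 4 * y ≤ 3 * n → 4 ^ a * y falling a ≤ 3 ^ a * n falling a
  falling-ratio zero    _ = ≤-refl
  falling-ratio {zero}  (suc a) _ = ≤-trans (≤-reflexive (*-zeroʳ (4 ^ suc a))) z≤n
  falling-ratio {suc y} {suc n} (suc a) le = begin
    4 ^ suc a * suc y falling suc a    ≡⟨ regroup 4 (4 ^ a) (suc y) (y falling a) ⟩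
    4 * suc y * (4 ^ a * y falling a)  ≤⟨ *-mono-≤ le (falling-ratio a le′) ⟩
    3 * suc n * (3 ^ a * n falling a)  ≡⟨ regroup 3 (3 ^ a) (suc n) (n falling a) ⟨
    3 ^ suc a * suc n falling suc a    ∎
    where
    open ≤-Reasoning
    regroup : ∀ k p y f → k * p * (y * f) ≡ k * y * (p * f)
    regroup = solve-∀
    le′ : 4 * y ≤ 3 * n
    le′ = +-cancelʳ-≤ 3 _ _ (begin
      4 * y + 3  ≤⟨ +-monoʳ-≤ (4 * y) (n≤1+n 3) ⟩
      4 * y + 4  ≡⟨ +-comm (4 * y) 4 ⟩
      4 + 4 * y  ≡⟨ *-suc 4 y ⟨
      4 * suc y  ≤⟨ le ⟩
      3 * suc n  ≡⟨ *-suc 3 n ⟩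
      3 + 3 * n  ≡⟨ +-comm 3 (3 * n) ⟩
      3 * n + 3  ∎)

  -- The exponent is a lower bound for `∣ P ∣`, so that one estimate serves constraints of all
  -- sizes. The surplus `e` is absorbed by `3 ^ e ≤ 4 ^ e`.
  misses-bound : ∀ (P Q : Subset n) {a₀} → a₀ ≤ ∣ P ∣ → n ≤ 4 * ∣ Q ∣ →
                 4 ^ a₀ * misses ((P , Q) ∷ []) ≤ 3 ^ a₀ * n !
  misses-bound {n} P Q {a₀} a₀≤a n≤4b = *-cancelˡ-≤ (4 ^ e) {{m^n≢0 4 e}} (begin
    4 ^ e * (4 ^ a₀ * misses ((P , Q) ∷ []))  ≡⟨ *-assoc (4 ^ e) (4 ^ a₀) _ ⟨
    4 ^ e * 4 ^ a₀ * misses ((P , Q) ∷ [])    ≡⟨ cong₂ _*_ 4^a (misses-single P Q) ⟩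
    4 ^ a * (y falling a * z !)               ≡⟨ *-assoc (4 ^ a) (y falling a) (z !) ⟨
    4 ^ a * y falling a * z !                 ≤⟨ *-monoˡ-≤ (z !) (falling-ratio a 4y≤3n) ⟩
    3 ^ a * n falling a * z !                 ≡⟨ *-assoc (3 ^ a) (n falling a) (z !) ⟩
    3 ^ a * (n falling a * z !)               ≡⟨ cong (3 ^ a *_) n! ⟨
    3 ^ a * n !                               ≡⟨ cong (λ a → 3 ^ a * n !) (m∸n+n≡m a₀≤a) ⟨
    3 ^ (e + a₀) * n !                        ≡⟨ cong (_* n !) (^-distribˡ-+-* 3 e a₀) ⟩
    3 ^ e * 3 ^ a₀ * n !                      ≤⟨ *-monoˡ-≤ (n !) (*-monoˡ-≤ (3 ^ a₀) (^-monoˡ-≤ e (n≤1+n 3))) ⟩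
    4 ^ e * 3 ^ a₀ * n !                      ≡⟨ *-assoc (4 ^ e) (3 ^ a₀) (n !) ⟩
    4 ^ e * (3 ^ a₀ * n !)                    ∎)
    where
    open ≤-Reasoning
    b = ∣ Q ∣
    y = ∣ ∁ Q ∣
    a = ∣ P ∣
    z = ∣ ∁ P ∣
    e = a ∸ a₀
    4^a : 4 ^ e * 4 ^ a₀ ≡ 4 ^ a
    4^a = trans (sym (^-distribˡ-+-* 4 e a₀)) (cong (4 ^_) (m∸n+n≡m a₀≤a))
    n! : n ! ≡ n falling a * z !
    n! = subst (λ n → n ! ≡ n falling a * z !) (∣p∣+∣∁p∣≡n P) (!-split a z)
    4y≤3n : 4 * y ≤ 3 * n
    4y≤3n = +-cancelˡ-≤ (4 * b) _ _ (begin
      4 * b + 4 * y  ≡⟨ *-distribˡ-+ 4 b y ⟨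
      4 * (b + y)    ≡⟨ cong (4 *_) (∣p∣+∣∁p∣≡n Q) ⟩
      n + 3 * n      ≤⟨ +-monoˡ-≤ (3 * n) n≤4b ⟩
      4 * b + 3 * n  ∎)

  -- Blocks of slots and the union bound over pairs of hub sets

  blowUp : ∀ d → Subset M → Subset (M * d)
  blowUp d A = concat (Vec.map (replicate d) A)

  ∣replicate-++∣ : ∀ d (p : Subset n) → ∣ replicate d true Vec.++ p ∣ ≡ d + ∣ p ∣
  ∣replicate-++∣ zero    p = refl
  ∣replicate-++∣ (suc d) p = cong suc (∣replicate-++∣ d p)

  ∣replicate-false-++∣ : ∀ d (p : Subset n) → ∣ replicate d false Vec.++ p ∣ ≡ ∣ p ∣
  ∣replicate-false-++∣ zero    p = refl
  ∣replicate-false-++∣ (suc d) p = ∣replicate-false-++∣ d p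

  ∣blowUp∣ : ∀ d (A : Subset M) → ∣ blowUp d A ∣ ≡ ∣ A ∣ * d
  ∣blowUp∣ d []          = refl
  ∣blowUp∣ d (true  ∷ A) = trans (∣replicate-++∣ d (blowUp d A)) (cong (d +_) (∣blowUp∣ d A))
  ∣blowUp∣ d (false ∷ A) = trans (∣replicate-false-++∣ d (blowUp d A)) (∣blowUp∣ d A)

  ∈-blowUp : ∀ d (A : Subset M) {i} → i ∈ blowUp d A →
             ∃[ a ] ∃[ j ] a ∈ A × i ≡ combine {M} {d} a j
  ∈-blowUp {M} d A {i} i∈ = a , j , lookup⇒[]= a A (begin
      lookup A a                                     ≡⟨ lookup-replicate j (lookup A a) ⟨
      lookup (replicate d (lookup A a)) j            ≡⟨ cong (λ v → lookup v j) (lookup-map a (replicate d) A) ⟨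
      lookup (lookup (Vec.map (replicate d) A) a) j  ≡⟨ lookup-concat (Vec.map (replicate d) A) a j ⟨
      lookup (blowUp d A) (combine a j)              ≡⟨ cong (lookup (blowUp d A)) (combine-remQuot {M} d i) ⟩
      lookup (blowUp d A) i                          ≡⟨ []=⇒lookup i∈ ⟩
      true                                           ∎) , sym (combine-remQuot {M} d i)
    where
    open ≡-Reasoning
    a = proj₁ (remQuot {M} d i)
    j = proj₂ (remQuot {M} d i)

  subsets : ∀ n → List (Subset n)
  subsets zero    = [] ∷ []
  subsets (suc n) = List.map (true ∷_) (subsets n) ++ List.map (false ∷_) (subsets n)

  ∈-subsets : ∀ (p : Subset n) → p ∈ₗ subsets n
  ∈-subsets []          = here refl
  ∈-subsets (true  ∷ p) = ∈-++⁺ˡ (∈-map⁺ (true ∷_) (∈-subsets p))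
  ∈-subsets (false ∷ p) = ∈-++⁺ʳ (List.map (true ∷_) (subsets _)) (∈-map⁺ (false ∷_) (∈-subsets p))

  length-subsets : ∀ n → length (subsets n) ≡ 2 ^ n
  length-subsets zero    = refl
  length-subsets (suc n) = begin
    length (List.map (true ∷_) (subsets n) ++ List.map (false ∷_) (subsets n))
      ≡⟨ length-++ (List.map (true ∷_) (subsets n)) ⟩
    length (List.map (true ∷_) (subsets n)) + length (List.map (false ∷_) (subsets n))
      ≡⟨ cong₂ _+_ (trans (length-map _ (subsets n)) (length-subsets n))
                   (trans (length-map _ (subsets n)) (length-subsets n)) ⟩
    2 ^ n + 2 ^ n
      ≡⟨ cong (2 ^ n +_) (+-identityʳ (2 ^ n)) ⟨
    2 ^ suc n ∎
    where open ≡-Reasoning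

  ^-^ : ∀ b c s → b ^ (s * c) ≡ (b ^ c) ^ s
  ^-^ b c s = trans (cong (b ^_) (*-comm s c)) (sym (^-*-assoc b c s))

  ^-distribʳ-* : ∀ a b s → (a * b) ^ s ≡ a ^ s * b ^ s
  ^-distribʳ-* a b zero    = refl
  ^-distribʳ-* a b (suc s) = trans (cong (a * b *_) (^-distribʳ-* a b s)) (interchange a b (a ^ s) (b ^ s))
    where
    interchange : ∀ a b x y → a * b * (x * y) ≡ a * x * (b * y)
    interchange = solve-∀

  length-cartesianProduct : ∀ {A B : Set} (xs : List A) (ys : List B) →
                            length (cartesianProduct xs ys) ≡ length xs * length ys
  length-cartesianProduct []       ys = refl
  length-cartesianProduct (x ∷ xs) ys = trans (length-++ (List.map (x ,_) ys))
    (cong₂ _+_ (length-map (x ,_) ys) (length-cartesianProduct xs ys))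

  Expanding : ∀ s M d → Permutation (M * d) (M * d) → Set
  Expanding s M d π = ∀ (A B : Subset M) → s ≤ ∣ A ∣ → s ≤ ∣ B ∣ →
    ∃[ a ] ∃[ i ] ∃[ b ] ∃[ j ] a ∈ A × b ∈ B × (π ⟨$⟩ʳ combine a i) ≡ combine {M} {d} b j

  Pairs : ℕ → Set
  Pairs n = List (Subset n × Subset n)

  Large : ℕ → Subset n × Subset n → Set
  Large s (A , B) = s ≤ ∣ A ∣ × s ≤ ∣ B ∣

  largePairs : ∀ s n → ∃[ ps ] All (Large s) ps × length ps ≤ 4 ^ n ×
               (∀ (p : Subset n × Subset n) → Large s p → p ∈ₗ ps)
  largePairs s n =
    filter large? allPairs , All.all-filter large? allPairs , few ,
    λ (A , B) large → ∈-filter⁺ large? (∈-cartesianProduct⁺ (∈-subsets A) (∈-subsets B)) large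
    where
    allPairs : Pairs n
    allPairs = cartesianProduct (subsets n) (subsets n)
    large? : Decidable (Large s)
    large? (A , B) = (s ≤? ∣ A ∣) ×-dec (s ≤? ∣ B ∣)
    few : length (filter large? allPairs) ≤ 4 ^ n
    few = begin
      length (filter large? allPairs)          ≤⟨ length-filter large? allPairs ⟩
      length allPairs                          ≡⟨ length-cartesianProduct (subsets n) (subsets n) ⟩
      length (subsets n) * length (subsets n)  ≡⟨ cong₂ _*_ (length-subsets n) (length-subsets n) ⟩
      2 ^ n * 2 ^ n                            ≡⟨ ^-distribʳ-* 2 2 n ⟨
      4 ^ n                                    ∎
      where open ≤-Reasoning

  blowUps : ∀ d → Subset M × Subset M → Constraint (M * d)
  blowUps d (A , B) = blowUp d A , blowUp d B

  module _ (d s : ℕ) where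

    private D = s * 4 * d

    ∣blowUp∣-≥ : ∀ (A : Subset M) → s ≤ ∣ A ∣ → s * d ≤ ∣ blowUp d A ∣
    ∣blowUp∣-≥ A s≤A = ≤-trans (*-monoˡ-≤ d s≤A) (≤-reflexive (sym (∣blowUp∣ d A)))

    -- The ratio 3/4 originates here: `s` of the `s * 4` hubs hold a quarter of all slots, so at
    -- most three quarters lie outside the target set.
    misses-blowUps : ∀ {p} → Large s p →
                     4 ^ (s * d) * misses (blowUps {s * 4} d p ∷ []) ≤ 3 ^ (s * d) * D !
    misses-blowUps {A , B} (s≤A , s≤B) = misses-bound (blowUp d A) (blowUp d B) (∣blowUp∣-≥ A s≤A)
      (≤-trans (≤-reflexive (shuffle s d)) (*-monoʳ-≤ 4 (∣blowUp∣-≥ B s≤B)))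
      where
      shuffle : ∀ s k → s * 4 * k ≡ 4 * (s * k)
      shuffle = solve-∀

    -- Both the number of pairs and the fraction of misses are bounded by `s`-th powers, so one
    -- numerical inequality in `d` settles every `s`. Raising it to the power `s` keeps it strict
    -- because `s` is positive.
    few-misses : 4 ^ 4 * 3 ^ d < 4 ^ d → 0 < s → (ps : Pairs (s * 4)) →
                 All (Large s) ps → length ps ≤ 4 ^ (s * 4) → misses (List.map (blowUps d) ps) < D !
    few-misses 4⁴3ᵈ<4ᵈ 0<s ps large few = *-cancelˡ-< (4 ^ (s * d)) _ _ (begin-strict
      4 ^ (s * d) * misses cs          ≤⟨ misses-≤ (4 ^ (s * d)) cs (All.map⁺ (All.map (λ {p} → misses-blowUps {p}) large)) ⟩
      length cs * (3 ^ (s * d) * D !)  ≡⟨ *-assoc (length cs) (3 ^ (s * d)) (D !) ⟨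
      length cs * 3 ^ (s * d) * D !    ≤⟨ *-monoˡ-≤ (D !) (*-monoˡ-≤ (3 ^ (s * d)) length-cs) ⟩
      4 ^ (s * 4) * 3 ^ (s * d) * D !  ≡⟨ cong (_* D !) (cong₂ _*_ (^-^ 4 4 s) (^-^ 3 d s)) ⟩
      (4 ^ 4) ^ s * (3 ^ d) ^ s * D !  ≡⟨ cong (_* D !) (^-distribʳ-* (4 ^ 4) (3 ^ d) s) ⟨
      (4 ^ 4 * 3 ^ d) ^ s * D !        <⟨ *-monoˡ-< (D !) {{D !≢0}} (^-monoˡ-< s {{>-nonZero 0<s}} 4⁴3ᵈ<4ᵈ) ⟩
      (4 ^ d) ^ s * D !                ≡⟨ cong (_* D !) (^-^ 4 d s) ⟨
      4 ^ (s * d) * D !                ∎)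
      where
      open ≤-Reasoning
      cs = List.map (blowUps d) ps
      length-cs : length cs ≤ 4 ^ (s * 4)
      length-cs = ≤-trans (≤-reflexive (length-map (blowUps d) ps)) few

  hits-blowUps : ∀ d {π} {p : Subset M × Subset M} → Hits π (blowUps d p) →
                 ∃[ a ] ∃[ i ] ∃[ b ] ∃[ j ] a ∈ proj₁ p × b ∈ proj₂ p ×
                   (π ⟨$⟩ʳ combine a i) ≡ combine {M} {d} b j
  hits-blowUps d {p = A , B} (_ , i∈ , πi∈)
    with a , i , a∈A , refl ← ∈-blowUp d A i∈
    with b , j , b∈B , eq   ← ∈-blowUp d B πi∈
    = a , i , b , j , a∈A , b∈B , eq

  -- Of the at most 4 ^ (4 * s) large pairs (A , B), each is missed by a fraction
  -- of at most (3/4) ^ (s * d) of all permutations.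
  expanding-permutation : ∀ d s → 4 ^ 4 * 3 ^ d < 4 ^ d → 0 < s →
                          ∃[ π ] Expanding s (s * 4) d π
  expanding-permutation d s 4⁴3ᵈ<4ᵈ 0<s
    with ps , large , few , complete ← largePairs s (s * 4)
    with π , hits ← hitting-permutation (List.map (blowUps d) ps)
                      (few-misses d s 4⁴3ᵈ<4ᵈ 0<s ps large few)
    = π , λ A B s≤A s≤B →
        hits-blowUps d {π} {A , B} (All.lookup hits (∈-map⁺ (blowUps d) (complete (A , B) (s≤A , s≤B))))

-- Closed sets of vertices and the robber's strategy

module Game where

  open import Data.Nat
  open import Data.Nat.Properties

  module _ {P : Fin n → Set} (P? : Decidable P) where

    comprehension : Subset n
    comprehension = tabulate (does ∘ P?)

    ∈-comprehension⁺ : ∀ {x} → P x → x ∈ comprehension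
    ∈-comprehension⁺ {x} px =
      lookup⇒[]= x comprehension (trans (lookup∘tabulate (does ∘ P?) x) (dec-true (P? x) px))

    ∈-comprehension⁻ : ∀ {x} → x ∈ comprehension → P x
    ∈-comprehension⁻ {x} x∈ with P? x | trans (sym (lookup∘tabulate (does ∘ P?) x)) ([]=⇒lookup x∈)
    ... | yes px | _ = px
    ... | no  _  | ()

  ∣p∪q∣≤∣p∣+∣q∣ : ∀ (p q : Subset n) → ∣ p ∪ q ∣ ≤ ∣ p ∣ + ∣ q ∣
  ∣p∪q∣≤∣p∣+∣q∣ []          []          = z≤n
  ∣p∪q∣≤∣p∣+∣q∣ (true ∷ p)  (false ∷ q) = s≤s (∣p∪q∣≤∣p∣+∣q∣ p q)
  ∣p∪q∣≤∣p∣+∣q∣ (true ∷ p)  (true ∷ q)  =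
    s≤s (≤-trans (∣p∪q∣≤∣p∣+∣q∣ p q) (+-monoʳ-≤ ∣ p ∣ (n≤1+n ∣ q ∣)))
  ∣p∪q∣≤∣p∣+∣q∣ (false ∷ p) (true ∷ q)  =
    ≤-trans (s≤s (∣p∪q∣≤∣p∣+∣q∣ p q)) (≤-reflexive (sym (+-suc ∣ p ∣ ∣ q ∣)))
  ∣p∪q∣≤∣p∣+∣q∣ (false ∷ p) (false ∷ q) = ∣p∪q∣≤∣p∣+∣q∣ p q

  module _ {P : Subset n → Set} (P? : Decidable P) (P⊥ : P ⊥)
           (P∪ : ∀ {S T} → P S → P T → P (S ∪ T)) where

    -- One member per point is enough: for each listed point a search over all subsets decides
    -- whether some member contains it, and the members found are joined.
    coverOf : ∀ (xs : List (Fin n)) → ∃[ U ] P U × (∀ {x S} → x ∈ₗ xs → P S → x ∈ S → x ∈ U)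
    coverOf []       = ⊥ , P⊥ , λ ()
    coverOf (x ∷ xs) with coverOf xs | anySubset? (λ S → P? S ×-dec (x ∈? S))
    ... | U , PU , ⊆U | yes (S , PS , x∈S) = S ∪ U , P∪ PS PU , λ where
      (here refl) _   _   → p⊆p∪q U x∈S
      (there y∈)  PS′ y∈S → q⊆p∪q S U (⊆U y∈ PS′ y∈S)
    ... | U , PU , ⊆U | no none = U , PU , λ where
      (here refl) PS x∈S → contradiction (_ , PS , x∈S) none
      (there y∈)  PS x∈S → ⊆U y∈ PS x∈S

    largest : ∃[ U ] P U × (∀ {S} → P S → S ⊆ U)
    largest with U , PU , ⊆U ← coverOf (allFin n) = U , PU , λ PS x∈S → ⊆U (∈-allFin _) PS x∈S

  x∈p─q⇒x∉q : ∀ (p q : Subset n) {x} → x ∈ p ─ q → x ∉ q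
  x∈p─q⇒x∉q (_ ∷ p) (true ∷ q) () here
  x∈p─q⇒x∉q (_ ∷ p) (_ ∷ q)    (there x∈) (there x∈q) = x∈p─q⇒x∉q p q x∈ x∈q

  _∈?ᵛ_ : ∀ (x : Maybe (Fin m)) (c : CopPositions m k) → Dec (x Vec.∈ c)
  x ∈?ᵛ c = DecVec._∈?_ (≡-dec Fin._≟_) x c

  ∈-moveCops : ∀ (mv : CopMove k) r (c : CopPositions m k) {x} →
               just x Vec.∈ moveCops mv r c → just x Vec.∈ c ⊎ x ≡ r
  ∈-moveCops nothing  r c x∈ = inj₁ x∈
  ∈-moveCops (just i) r c x∈ = replaced i c x∈
    where
    replaced : ∀ {k} i (c : CopPositions _ k) {x} → just x Vec.∈ c [ i ]≔ just r → just x Vec.∈ c ⊎ x ≡ r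
    replaced zero    (y ∷ c) (VecAny.here eq)  = inj₂ (just-injective eq)
    replaced zero    (y ∷ c) (VecAny.there x∈) = inj₁ (VecAny.there x∈)
    replaced (suc i) (y ∷ c) (VecAny.here eq)  = inj₁ (VecAny.here eq)
    replaced (suc i) (y ∷ c) (VecAny.there x∈) = [ inj₁ ∘ VecAny.there , inj₂ ]′ (replaced i c x∈)

  occupied : CopPositions m k → Subset m
  occupied []            = ⊥
  occupied (nothing ∷ c) = occupied c
  occupied (just x ∷ c)  = ⁅ x ⁆ ∪ occupied c

  ∈-occupied : ∀ (c : CopPositions m k) {x} → just x Vec.∈ c → x ∈ occupied c
  ∈-occupied (just x ∷ c)  (VecAny.here refl) = p⊆p∪q (occupied c) (x∈⁅x⁆ x)
  ∈-occupied (just y ∷ c)  (VecAny.there x∈)  = q⊆p∪q ⁅ y ⁆ (occupied c) (∈-occupied c x∈)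
  ∈-occupied (nothing ∷ c) (VecAny.there x∈)  = ∈-occupied c x∈

  -- A digraph in which some vertices are grouped into M hubs; colour x is the
  -- hub of x, if any.
  module Hubs (G : Digraph m) (colour : Fin m → Maybe (Fin M)) where
    open Digraph G

    HubsNonempty : Set
    HubsNonempty = ∀ v → ∃[ x ] colour x ≡ just v

    -- Strong connectivity stated through sets instead of paths. A set closed with respect to the
    -- cops satisfies the premise at every cop-free hub, so it contains such a hub entirely or
    -- avoids it.
    HubsConnected : Set
    HubsConnected = ∀ v (S : Subset m) →
      (∀ {x y} → x ∈ S → x ⟶ y → colour y ≡ just v → y ∈ S) →
      ∀ {x y} → colour x ≡ just v → colour y ≡ just v → x ∈ S → y ∈ S

    HubsExpanding : ℕ → Set
    HubsExpanding s = ∀ (A B : Subset M) → s ≤ ∣ A ∣ → s ≤ ∣ B ∣ →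
      ∃[ x ] ∃[ y ] ∃[ a ] ∃[ b ] (x ⟶ y) × colour x ≡ just a × colour y ≡ just b × a ∈ A × b ∈ B

    Meets : Subset m → Fin M → Set
    Meets S v = ∃[ x ] x ∈ S × colour x ≡ just v

    meets? : ∀ S → Decidable (Meets S)
    meets? S v = any? λ x → (x ∈? S) ×-dec ≡-dec Fin._≟_ (colour x) (just v)

    trace : Subset m → Subset M
    trace S = comprehension (meets? S)

    trace-⊆ : ∀ S {T} → (∀ {x v} → x ∈ S → colour x ≡ just v → v ∈ T) → trace S ⊆ T
    trace-⊆ S S⊆T v∈ with x , x∈S , eq ← ∈-comprehension⁻ (meets? S) v∈ = S⊆T x∈S eq

    ∈-trace : ∀ {S x v} → x ∈ S → colour x ≡ just v → v ∈ trace S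
    ∈-trace {S} x∈S eq = ∈-comprehension⁺ (meets? S) (_ , x∈S , eq)

    ∣trace-∪∣ : ∀ S T → ∣ trace (S ∪ T) ∣ ≤ ∣ trace S ∣ + ∣ trace T ∣
    ∣trace-∪∣ S T = ≤-trans (p⊆q⇒∣p∣≤∣q∣ (trace-⊆ (S ∪ T) split)) (∣p∪q∣≤∣p∣+∣q∣ (trace S) (trace T))
      where
      split : ∀ {x v} → x ∈ S ∪ T → colour x ≡ just v → v ∈ trace S ∪ trace T
      split x∈ eq = [ (λ x∈S → p⊆p∪q (trace T) (∈-trace x∈S eq))
                    , (λ x∈T → q⊆p∪q (trace S) (trace T) (∈-trace x∈T eq)) ]′ (x∈p∪q⁻ S T x∈)

    ∣trace-⊥∣ : ∣ trace ⊥ ∣ ≤ 0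
    ∣trace-⊥∣ = ≤-trans (p⊆q⇒∣p∣≤∣q∣ (trace-⊆ ⊥ {⊥} (λ x∈⊥ → contradiction x∈⊥ ∉⊥))) (≤-reflexive (∣⊥∣≡0 M))

    ∣trace-⁅x⁆∣ : ∀ x → ∣ trace ⁅ x ⁆ ∣ ≤ 1
    ∣trace-⁅x⁆∣ x with colour x in eq
    ... | just v  = ≤-trans (p⊆q⇒∣p∣≤∣q∣ (trace-⊆ ⁅ x ⁆ only-v)) (≤-reflexive (∣⁅x⁆∣≡1 v))
      where
      only-v : ∀ {y w} → y ∈ ⁅ x ⁆ → colour y ≡ just w → w ∈ ⁅ v ⁆
      only-v y∈ eq′ with refl ← x∈⁅y⁆⇒x≡y x y∈ with refl ← trans (sym eq) eq′ = x∈⁅x⁆ v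
    ... | nothing = ≤-trans (p⊆q⇒∣p∣≤∣q∣ (trace-⊆ ⁅ x ⁆ {⊥} none)) (≤-trans (≤-reflexive (∣⊥∣≡0 M)) z≤n)
      where
      none : ∀ {y w} → y ∈ ⁅ x ⁆ → colour y ≡ just w → w ∈ ⊥
      none y∈ eq′ with refl ← x∈⁅y⁆⇒x≡y x y∈ with () ← trans (sym eq) eq′

    ∣trace-occupied∣ : ∀ (c : CopPositions m k) → ∣ trace (occupied c) ∣ ≤ k
    ∣trace-occupied∣ []            = ∣trace-⊥∣
    ∣trace-occupied∣ (nothing ∷ c) = m≤n⇒m≤1+n (∣trace-occupied∣ c)
    ∣trace-occupied∣ (just x ∷ c)  =
      ≤-trans (∣trace-∪∣ ⁅ x ⁆ (occupied c)) (+-mono-≤ (∣trace-⁅x⁆∣ x) (∣trace-occupied∣ c))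

    -- A robber in `S` cannot leave `S` as long as the cops stand at `c`.
    Closed : CopPositions m k → Subset m → Set
    Closed c S = ∀ x y → x ∈ S → x ⟶ y → just y Vec.∉ c → y ∈ S

    closed? : ∀ (c : CopPositions m k) → Decidable (Closed c)
    closed? c S = all? λ x → all? λ y →
      (x ∈? S) →-dec (y ∈? outNeighbours x) →-dec ¬? (just y ∈?ᵛ c) →-dec (y ∈? S)

    closed-∪ : ∀ {c : CopPositions m k} {S T} → Closed c S → Closed c T → Closed c (S ∪ T)
    closed-∪ {S = S} {T} closedS closedT x y x∈ x⟶y free =
      [ (λ x∈S → p⊆p∪q T (closedS x y x∈S x⟶y free))
      , (λ x∈T → q⊆p∪q S T (closedT x y x∈T x⟶y free)) ]′ (x∈p∪q⁻ S T x∈)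

    module _ (connected : HubsConnected) {s} (expanding : HubsExpanding s) where

      -- Consider the cop-free hubs: those met by S lie in S, so no arc leads from
      -- them to the others.  Hence one of the two kinds is rare.
      small-or-large : ∀ (c : CopPositions m k) S → Closed c S →
                       ∣ trace S ∣ ≤ s + k ⊎ M ≤ ∣ trace S ∣ + (s + k)
      small-or-large {k} c S closed =
        [ (λ s≤A → [ (λ s≤B → Empty.⊥-elim (not-both s≤A s≤B)) , inj₂ ∘ few-unmet ]′ (≤-<-connex s ∣ B ∣))
        , inj₁ ∘ few-met ]′ (≤-<-connex s ∣ A ∣)
        where
        open ≤-Reasoning
        O = trace (occupied c)
        A = trace S ─ O
        B = ∁ (trace S ∪ O)

        few-met : ∣ A ∣ < s → ∣ trace S ∣ ≤ s + k
        few-met A<s = begin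
          ∣ trace S ∣    ≤⟨ p⊆q⇒∣p∣≤∣q∣ covered ⟩
          ∣ A ∪ O ∣      ≤⟨ ∣p∪q∣≤∣p∣+∣q∣ A O ⟩
          ∣ A ∣ + ∣ O ∣  ≤⟨ +-mono-≤ (<⇒≤ A<s) (∣trace-occupied∣ c) ⟩
          s + k          ∎
          where
          covered : trace S ⊆ A ∪ O
          covered {v} v∈ with v ∈? O
          ... | yes v∈O = q⊆p∪q A O v∈O
          ... | no  v∉O = p⊆p∪q O (x∈p∧x∉q⇒x∈p─q v∈ v∉O)

        few-unmet : ∣ B ∣ < s → M ≤ ∣ trace S ∣ + (s + k)
        few-unmet B<s = begin
          M                        ≡⟨ ∣⊤∣≡n M ⟨
          ∣ ⊤ {M} ∣                ≡⟨ cong ∣_∣ (p∪∁p≡⊤ (trace S ∪ O)) ⟨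
          ∣ (trace S ∪ O) ∪ B ∣    ≤⟨ ∣p∪q∣≤∣p∣+∣q∣ (trace S ∪ O) B ⟩
          ∣ trace S ∪ O ∣ + ∣ B ∣  ≤⟨ +-mono-≤ (∣p∪q∣≤∣p∣+∣q∣ (trace S) O) (<⇒≤ B<s) ⟩
          ∣ trace S ∣ + ∣ O ∣ + s  ≤⟨ +-monoˡ-≤ s (+-monoʳ-≤ ∣ trace S ∣ (∣trace-occupied∣ c)) ⟩
          ∣ trace S ∣ + k + s      ≡⟨ +-assoc ∣ trace S ∣ k s ⟩
          ∣ trace S ∣ + (k + s)    ≡⟨ cong (∣ trace S ∣ +_) (+-comm k s) ⟩
          ∣ trace S ∣ + (s + k)    ∎

        free : ∀ {v} → v ∉ O → ∀ {z} → colour z ≡ just v → just z Vec.∉ c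
        free v∉O col-z z∈c = v∉O (∈-trace (∈-occupied c z∈c) col-z)

        not-both : s ≤ ∣ A ∣ → s ≤ ∣ B ∣ → Empty.⊥
        not-both s≤A s≤B
          with x , y , a , b , x⟶y , col-x , col-y , a∈A , b∈B ← expanding A B s≤A s≤B
          with z , z∈S , col-z ← ∈-comprehension⁻ (meets? S) (p─q⊆p (trace S) O a∈A)
          = b∉ (p⊆p∪q O (∈-trace y∈S col-y))
          where
          b∉ = x∈∁p⇒x∉p b∈B
          x∈S : x ∈ S
          x∈S = connected a S
            (λ u∈ u⟶w col-w → closed _ _ u∈ u⟶w (free (x∈p─q⇒x∉q (trace S) O a∈A) col-w)) col-z col-x z∈S
          y∈S : y ∈ S
          y∈S = closed x y x∈S x⟶y (free (b∉ ∘ q⊆p∪q (trace S) O) col-y)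

      module _ (nonempty : HubsNonempty) {k} (0<s : 0 < s) (3[s+k]<M : 3 * (s + k) < M) where

        private q = s + k

        Small : CopPositions m k → Subset m → Set
        Small c S = Closed c S × ∣ trace S ∣ ≤ q

        not-large : ∀ {x} → x ≤ q + q → ¬ M ≤ x + q
        not-large {x} x≤2q M≤ = <-irrefl refl (begin-strict
          3 * q      <⟨ 3[s+k]<M ⟩
          M          ≤⟨ M≤ ⟩
          x + q      ≤⟨ +-monoˡ-≤ q x≤2q ⟩
          q + q + q  ≡⟨ triple q ⟩
          3 * q      ∎)
          where
          open ≤-Reasoning
          triple : ∀ q → q + q + q ≡ 3 * q
          triple = solve-∀

        -- The gap in the possible trace sizes does the work: a trace of at most `q + q` is too
        -- small for the upper range, so it falls back to at most `q`. Hence unions can be iterated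
        -- without the bound growing.
        closed-small : ∀ c S → Closed c S → ∣ trace S ∣ ≤ q + q → Small c S
        closed-small c S closed ≤2q with small-or-large c S closed
        ... | inj₁ small = closed , small
        ... | inj₂ large = contradiction large (not-large ≤2q)

        small-∪ : ∀ {c S T} → Small c S → Small c T → Small c (S ∪ T)
        small-∪ {c} {S} {T} (closedS , smallS) (closedT , smallT) =
          closed-small c (S ∪ T) (closed-∪ closedS closedT)
            (≤-trans (∣trace-∪∣ S T) (+-mono-≤ smallS smallT))

        small? : ∀ c → Decidable (Small c)
        small? c S = closed? c S ×-dec (∣ trace S ∣ ≤? q)

        largest-small : ∀ c → ∃[ U ] Small c U × (∀ {S} → Small c S → S ⊆ U)
        largest-small c = largest (small? c) ((λ x y x∈⊥ → contradiction x∈⊥ ∉⊥) , ≤-trans ∣trace-⊥∣ z≤n) small-∪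

        -- The trap depends only on where the cops stand now, so the robber needs no memory of the
        -- earlier play.
        trap : CopPositions m k → Subset m
        trap c = proj₁ (largest-small c)

        -- Otherwise v could be added to the trap of c′, which would make it a
        -- small closed set for c containing v.
        escape : ∀ {c c′ v} → (∀ {x} → just x Vec.∈ c′ → just x Vec.∈ c ⊎ x ≡ v) → v ∉ trap c →
                 ∃[ u ] (v ⟶ u) × just u Vec.∉ c′ × u ∉ trap c′
        escape {c} {c′} {v} moved v∉
          with any? (λ u → (u ∈? outNeighbours v) ×-dec ¬? (just u ∈?ᵛ c′) ×-dec ¬? (u ∈? trap c′))
        ... | yes found = found
        ... | no  stuck = contradiction (proj₂ (proj₂ (largest-small c)) U∪v-small v∈) v∉
          where
          U = trap c′
          U-small = proj₁ (proj₂ (largest-small c′))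

          v∈ : v ∈ U ∪ ⁅ v ⁆
          v∈ = q⊆p∪q U ⁅ v ⁆ (x∈⁅x⁆ v)

          U∪v-closed : Closed c (U ∪ ⁅ v ⁆)
          U∪v-closed x y x∈ x⟶y y∉c with just y ∈?ᵛ c′
          -- Only the landing place `v` of the flying cop can be newly occupied, and `v` has been
          -- added to the set. A vertex that the cop abandons is still occupied in `c`, so it
          -- demands nothing.
          ... | yes y∈c′ = [ (λ y∈c → contradiction y∈c y∉c) , (λ { refl → v∈ }) ]′ (moved y∈c′)
          ... | no y∉c′ = p⊆p∪q ⁅ v ⁆ ([ (λ x∈U → proj₁ U-small x y x∈U x⟶y y∉c′) , from-v ]′ (x∈p∪q⁻ U ⁅ v ⁆ x∈))
            where
            from-v : x ∈ ⁅ v ⁆ → y ∈ U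
            from-v x∈v with refl ← x∈⁅y⁆⇒x≡y v x∈v =
              decidable-stable (y ∈? U) (λ y∉U → stuck (y , x⟶y , y∉c′ , y∉U))

          U∪v-small : Small c (U ∪ ⁅ v ⁆)
          U∪v-small = closed-small c (U ∪ ⁅ v ⁆) U∪v-closed (begin
            ∣ trace (U ∪ ⁅ v ⁆) ∣          ≤⟨ ∣trace-∪∣ U ⁅ v ⁆ ⟩
            ∣ trace U ∣ + ∣ trace ⁅ v ⁆ ∣  ≤⟨ +-mono-≤ (proj₂ U-small) (∣trace-⁅x⁆∣ v) ⟩
            -- The new vertex costs at most one hub, and `q` is at least `s`, hence at least 1.
            q + 1                          ≤⟨ +-monoʳ-≤ q (≤-trans 0<s (m≤m+n s k)) ⟩
            q + q                          ∎)
            where open ≤-Reasoning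

        -- Each hub has a vertex, so a trap containing every vertex would meet all `M` hubs, more
        -- than the `q` allowed.
        start : ∀ c → ∃[ v ] v ∉ trap c
        start c with any? (λ v → ¬? (v ∈? trap c))
        ... | yes found = found
        ... | no  none  = contradiction M≤ (not-large z≤n)
          where
          everything : ∀ x → x ∈ trap c
          everything x = decidable-stable (x ∈? trap c) (λ x∉ → none (x , x∉))
          M≤ : M ≤ 0 + q
          M≤ = begin
            M                   ≡⟨ ∣⊤∣≡n M ⟨
            ∣ ⊤ {M} ∣           ≤⟨ p⊆q⇒∣p∣≤∣q∣ {p = ⊤} (λ {v} _ → ∈-trace (everything (proj₁ (nonempty v))) (proj₂ (nonempty v))) ⟩
            ∣ trace (trap c) ∣  ≤⟨ proj₂ (proj₁ (proj₂ (largest-small c))) ⟩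
            q                   ∎
            where open ≤-Reasoning

        -- `past` stops just before the current vertex; the cops' strategy is consulted on
        -- `past ∷ʳ robber`. The history serves only to feed that strategy.
        record Position : Set where
          constructor position
          field
            past   : List (Fin m)
            cops   : CopPositions m k
            robber : Fin m
            safe   : robber ∉ trap cops
        open Position

        module _ (σ : CopStrategy m k) where

          move : Position → Position
          move (position h c v v∉) with escape {c} {moveCops (σ (h ∷ʳ v)) v c} {v} (∈-moveCops (σ (h ∷ʳ v)) v c) v∉
          ... | u , _ , _ , u∉ = position (h ∷ʳ v) (moveCops (σ (h ∷ʳ v)) v c) u u∉

          move-legal : ∀ p → (robber p ⟶ robber (move p)) × just (robber (move p)) Vec.∉ cops (move p)
          move-legal (position h c v v∉) with escape {c} {moveCops (σ (h ∷ʳ v)) v c} {v} (∈-moveCops (σ (h ∷ʳ v)) v c) v∉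
          ... | u , v⟶u , free , _ = v⟶u , free

          play : ℕ → Position
          play zero    = position [] (Vec.replicate k nothing) (proj₁ (start _)) (proj₂ (start _))
          play (suc t) = move (play t)

          run : ℕ → Fin m
          run t = robber (play t)

          -- The run and the cops' moves determine each other, whereas `copsAt` takes a complete run
          -- as its argument. So the positions carry their own history and cops, and these are
          -- identified with the official ones once the run exists.
          play-past : ∀ t → past (play t) ≡ applyUpTo run t
          play-past zero    = refl
          play-past (suc t) = trans (cong (_∷ʳ run t) (play-past t)) (applyUpTo-∷ʳ run t)

          play-cops : ∀ t → cops (play t) ≡ copsAt σ run t
          play-cops zero    = refl
          play-cops (suc t) = cong₂ (λ h c → moveCops (σ h) (run t) c) (play-past (suc t)) (play-cops t)

          run-evades : EvadesForever G σ run
          run-evades t = proj₁ (move-legal (play t)) ,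
            subst (just (run (suc t)) Vec.∉_) (play-cops (suc t)) (proj₂ (move-legal (play t)))

        robber-wins : ¬ CopsCatch G k
        robber-wins (σ , catches) = catches (run σ) (run-evades σ)

-- The cubic digraph and its hubs

module Graph where

  open import Data.Nat
  open import Data.Nat.Properties
  open Counting using (Expanding)
  open Game

  fromList : List (Fin n) → Subset n
  fromList = foldr (λ x S → ⁅ x ⁆ ∪ S) ⊥

  ∈-fromList⁺ : ∀ {xs} {x : Fin n} → x ∈ₗ xs → x ∈ fromList xs
  ∈-fromList⁺ {xs = x ∷ xs} (here refl) = p⊆p∪q (fromList xs) (x∈⁅x⁆ x)
  ∈-fromList⁺ {xs = x ∷ xs} (there x∈)  = q⊆p∪q ⁅ x ⁆ (fromList xs) (∈-fromList⁺ x∈)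

  ∈-fromList⁻ : ∀ xs {x : Fin n} → x ∈ fromList xs → x ∈ₗ xs
  ∈-fromList⁻ []       x∈ = contradiction x∈ ∉⊥
  ∈-fromList⁻ (y ∷ xs) x∈ =
    [ here ∘ x∈⁅y⁆⇒x≡y y , there ∘ ∈-fromList⁻ xs ]′ (x∈p∪q⁻ ⁅ y ⁆ (fromList xs) x∈)

  ∣⁅x⁆∪p∣ : ∀ (x : Fin n) p → x ∉ p → ∣ ⁅ x ⁆ ∪ p ∣ ≡ suc ∣ p ∣
  ∣⁅x⁆∪p∣ zero    (true  ∷ p) x∉p = contradiction here x∉p
  ∣⁅x⁆∪p∣ zero    (false ∷ p) x∉p = cong (suc ∘ ∣_∣) (∪-identityˡ p)
  ∣⁅x⁆∪p∣ (suc x) (true  ∷ p) x∉p = cong suc (∣⁅x⁆∪p∣ x p (x∉p ∘ there))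
  ∣⁅x⁆∪p∣ (suc x) (false ∷ p) x∉p = ∣⁅x⁆∪p∣ x p (x∉p ∘ there)

  ∣fromList∣ : ∀ {xs : List (Fin n)} → Unique xs → ∣ fromList xs ∣ ≡ length xs
  ∣fromList∣ {n} []         = ∣⊥∣≡0 n
  ∣fromList∣ {xs = x ∷ xs} (x≢ ∷ xs!) =
    trans (∣⁅x⁆∪p∣ x (fromList xs) (All.All¬⇒¬Any x≢ ∘ ∈-fromList⁻ xs)) (cong suc (∣fromList∣ xs!))

  -- With predecessors listed next to successors, in-degrees become list lengths as well, and
  -- regularity can be read off vertex by vertex.
  module FromNeighbours
    {V : Set} (V↔ : Fin m ↔ V) (succs preds : V → List V)
    (succs-unique : ∀ v → Unique (succs v)) (preds-unique : ∀ v → Unique (preds v))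
    (succs⇒preds : ∀ {v w} → w ∈ₗ succs v → v ∈ₗ preds w)
    (preds⇒succs : ∀ {v w} → v ∈ₗ preds w → w ∈ₗ succs v)
    (irreflexive : ∀ v → v ∉ₗ succs v)
    where

    open Inverse V↔ using (to; from; strictlyInverseˡ; strictlyInverseʳ)

    vertices : List V → Subset m
    vertices vs = fromList (List.map from vs)

    ∈-vertices⁺ : ∀ {x vs} → to x ∈ₗ vs → x ∈ vertices vs
    ∈-vertices⁺ {x} {vs} x∈ = ∈-fromList⁺ (subst (_∈ₗ List.map from vs) (strictlyInverseʳ x) (∈-map⁺ from x∈))

    ∈-vertices⁻ : ∀ {x vs} → x ∈ vertices vs → to x ∈ₗ vs
    ∈-vertices⁻ {x} {vs} x∈ with v , v∈ , refl ← ∈-map⁻ from (∈-fromList⁻ (List.map from vs) x∈) =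
      subst (_∈ₗ vs) (sym (strictlyInverseˡ v)) v∈

    from-injective : ∀ {v w} → from v ≡ from w → v ≡ w
    from-injective {v} {w} eq = trans (sym (strictlyInverseˡ v)) (trans (cong to eq) (strictlyInverseˡ w))

    ∣vertices∣ : ∀ {vs} → Unique vs → ∣ vertices vs ∣ ≡ length vs
    ∣vertices∣ {vs} vs! = trans (∣fromList∣ (map⁺ from-injective vs!)) (length-map from vs)

    digraph : Digraph m
    digraph = record
      { outNeighbours = λ x → vertices (succs (to x))
      ; noLoops       = λ x → irreflexive (to x) ∘ ∈-vertices⁻
      }

    open Digraph digraph

    arc : ∀ {v w} → w ∈ₗ succs v → from v ⟶ from w
    arc {v} {w} w∈ = ∈-vertices⁺ (subst₂ (λ v w → w ∈ₗ succs v) (sym (strictlyInverseˡ v)) (sym (strictlyInverseˡ w)) w∈)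

    inNeighbours-preds : ∀ y → inNeighbours y ≡ vertices (preds (to y))
    inNeighbours-preds y = ⊆-antisym
      (λ {x} x∈ → ∈-vertices⁺ (succs⇒preds (∈-vertices⁻
        (lookup⇒[]= y _ (trans (sym (lookup∘tabulate (λ u → lookup (outNeighbours u) y) x)) ([]=⇒lookup x∈))))))
      (λ {x} x∈ → lookup⇒[]= x _ (trans (lookup∘tabulate (λ u → lookup (outNeighbours u) y) x)
        ([]=⇒lookup (∈-vertices⁺ (preds⇒succs (∈-vertices⁻ x∈))))))

    regular : ∀ {d} → (∀ v → length (preds v) + length (succs v) ≡ d) → Regular d digraph
    regular degrees x = trans
      (cong₂ _+_ (trans (cong ∣_∣ (inNeighbours-preds x)) (∣vertices∣ (preds-unique (to x))))
                 (∣vertices∣ (succs-unique (to x))))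
      (degrees (to x))

  -- Every slot i carries four vertices (i , 0F), …, (i , 3F).  Contracting them
  -- turns the graph into the digraph with the arcs i ⟶ π i and i ⟶ ρ i; the
  -- 2-cycle between (i , 2F) and (i , 3F) rules out parallel arcs for all π and ρ.
  module SlotGraph {L} (π ρ : Permutation L L) where

    V : Set
    V = Fin L × Fin 4

    succs preds : V → List V
    succs (i , 0F) = (i , 1F) ∷ []
    succs (i , 1F) = (i , 2F) ∷ (π ⟨$⟩ʳ i , 0F) ∷ []
    succs (i , 2F) = (i , 3F) ∷ []
    succs (i , 3F) = (i , 2F) ∷ (ρ ⟨$⟩ʳ i , 0F) ∷ []
    preds (i , 0F) = (π ⟨$⟩ˡ i , 1F) ∷ (ρ ⟨$⟩ˡ i , 3F) ∷ []
    preds (i , 1F) = (i , 0F) ∷ []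
    preds (i , 2F) = (i , 1F) ∷ (i , 3F) ∷ []
    preds (i , 3F) = (i , 2F) ∷ []

    succs-unique : ∀ v → Unique (succs v)
    succs-unique (i , 0F) = [] ∷ []
    succs-unique (i , 1F) = ((λ ()) ∷ []) ∷ [] ∷ []
    succs-unique (i , 2F) = [] ∷ []
    succs-unique (i , 3F) = ((λ ()) ∷ []) ∷ [] ∷ []

    preds-unique : ∀ v → Unique (preds v)
    preds-unique (i , 0F) = ((λ ()) ∷ []) ∷ [] ∷ []
    preds-unique (i , 1F) = [] ∷ []
    preds-unique (i , 2F) = ((λ ()) ∷ []) ∷ [] ∷ []
    preds-unique (i , 3F) = [] ∷ []

    succs⇒preds : ∀ {v w} → w ∈ₗ succs v → v ∈ₗ preds w
    succs⇒preds {i , 0F} (here refl)         = here refl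
    succs⇒preds {i , 1F} (here refl)         = here refl
    succs⇒preds {i , 1F} (there (here refl)) = here (cong (_, 1F) (sym (inverseˡ π)))
    succs⇒preds {i , 2F} (here refl)         = here refl
    succs⇒preds {i , 3F} (here refl)         = there (here refl)
    succs⇒preds {i , 3F} (there (here refl)) = there (here (cong (_, 3F) (sym (inverseˡ ρ))))

    preds⇒succs : ∀ {v w} → v ∈ₗ preds w → w ∈ₗ succs v
    preds⇒succs {w = i , 0F} (here refl)         = there (here (cong (_, 0F) (sym (inverseʳ π))))
    preds⇒succs {w = i , 0F} (there (here refl)) = there (here (cong (_, 0F) (sym (inverseʳ ρ))))
    preds⇒succs {w = i , 1F} (here refl)         = here refl
    preds⇒succs {w = i , 2F} (here refl)         = here refl
    preds⇒succs {w = i , 2F} (there (here refl)) = here refl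
    preds⇒succs {w = i , 3F} (here refl)         = here refl

    irreflexive : ∀ v → v ∉ₗ succs v
    irreflexive (i , 0F) (here ())
    irreflexive (i , 1F) (here ())
    irreflexive (i , 1F) (there (here ()))
    irreflexive (i , 2F) (here ())
    irreflexive (i , 3F) (here ())
    irreflexive (i , 3F) (there (here ()))

    open FromNeighbours *↔× succs preds succs-unique preds-unique succs⇒preds preds⇒succs irreflexive
      public using (digraph; arc; regular)

    cubic : Regular 3 digraph
    cubic = regular λ where
      (i , 0F) → refl
      (i , 1F) → refl
      (i , 2F) → refl
      (i , 3F) → refl

  -- The cyclic shift: the last point goes to 0 and the others keep their order, so each of them
  -- moves up by one.
  rotate : ∀ d → Permutation (suc d) (suc d)
  rotate d = insert (fromℕ d) zero Perm.id

  punchIn-fromℕ : ∀ {d} (j : Fin d) → punchIn (fromℕ d) j ≡ inject₁ j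
  punchIn-fromℕ zero    = refl
  punchIn-fromℕ (suc j) = cong suc (punchIn-fromℕ j)

  rotate-inject₁ : ∀ {d} (j : Fin d) → rotate d ⟨$⟩ʳ inject₁ j ≡ suc j
  rotate-inject₁ {d} j = trans (cong (rotate d ⟨$⟩ʳ_) (sym (punchIn-fromℕ j)))
                               (insert-punchIn (fromℕ d) zero Perm.id j)

  rotate-fromℕ : ∀ d → rotate d ⟨$⟩ʳ fromℕ d ≡ zero
  rotate-fromℕ d with fromℕ d Fin.≟ fromℕ d
  ... | yes _ = refl
  ... | no ≢  = contradiction refl ≢

  -- Climb from `i` to the last point, wrap around to 0, and climb from there to every point.
  rotate-transitive : ∀ {d} (P : Fin (suc d) → Set) → (∀ j → P j → P (rotate d ⟨$⟩ʳ j)) →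
                      ∀ {i} → P i → ∀ j → P j
  rotate-transitive {d} P step {i} Pi =
    <-weakInduction P
      (subst P (rotate-fromℕ d) (step (fromℕ d) (<-weakInduction-startingFrom P Pi next (≤fromℕ i)))) next
    where
    next : ∀ j → P (inject₁ j) → P (suc j)
    next j = subst P (rotate-inject₁ j) ∘ step (inject₁ j)

  extend : ∀ r → Permutation n n → Permutation (n + r) (n + r)
  extend r π = ↔-sym +↔⊎ ↔-∘ ((π ⊎-↔ ↔-id (Fin r)) ↔-∘ +↔⊎)

  extend-↑ˡ : ∀ r (π : Permutation n n) i → extend r π ⟨$⟩ʳ (i ↑ˡ r) ≡ (π ⟨$⟩ʳ i) ↑ˡ r
  extend-↑ˡ {n} r π i rewrite splitAt-↑ˡ n i r = refl

  inBlocks : ∀ M → Permutation n n → Permutation (M * n) (M * n)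
  inBlocks M ρ = ↔-sym *↔× ↔-∘ ((↔-id (Fin M) ×-↔ ρ) ↔-∘ *↔×)

  inBlocks-combine : ∀ M (ρ : Permutation n n) v j →
                     inBlocks M ρ ⟨$⟩ʳ combine v j ≡ combine {M} v (ρ ⟨$⟩ʳ j)
  inBlocks-combine M ρ v j = cong (λ (v , j) → combine {M} v (ρ ⟨$⟩ʳ j)) (remQuot-combine v j)

  -- The last r slots lie outside all hubs; they only make up the number of vertices.
  module HubGraph (M d r : ℕ) (π : Permutation (M * suc d) (M * suc d)) where

    L = M * suc d + r

    ρ : Permutation L L
    ρ = extend r (inBlocks M (rotate d))

    open SlotGraph (extend r π) ρ using (digraph; arc; cubic) public
    open Digraph digraph

    hubOfSlot : Fin L → Maybe (Fin M)
    hubOfSlot i = [ just ∘ quotient {M} (suc d) , const nothing ]′ (splitAt (M * suc d) i)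

    colour : Fin (L * 4) → Maybe (Fin M)
    colour x = hubOfSlot (quotient {L} 4 x)

    vertex : Fin M → Fin (suc d) → Fin 4 → Fin (L * 4)
    vertex v j p = combine (combine v j ↑ˡ r) p

    colour-vertex : ∀ v j p → colour (vertex v j p) ≡ just v
    colour-vertex v j p = begin
      hubOfSlot (quotient {L} 4 (vertex v j p))  ≡⟨ cong (hubOfSlot ∘ proj₁) (remQuot-combine (combine v j ↑ˡ r) p) ⟩
      hubOfSlot (combine v j ↑ˡ r)               ≡⟨ cong [ just ∘ quotient {M} (suc d) , const nothing ]′ (splitAt-↑ˡ (M * suc d) (combine v j) r) ⟩
      just (quotient {M} (suc d) (combine v j))  ≡⟨ cong (just ∘ proj₁) (remQuot-combine v j) ⟩
      just v                                     ∎
      where open ≡-Reasoning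

    coloured : ∀ {x v} → colour x ≡ just v → ∃[ j ] ∃[ p ] x ≡ vertex v j p
    coloured {x} eq with splitAt (M * suc d) (quotient {L} 4 x) in split
    coloured {x} refl | inj₁ y =
      proj₂ (remQuot {M} (suc d) y) , proj₂ (remQuot {L} 4 x) , (begin
        x                             ≡⟨ combine-remQuot {L} 4 x ⟨
        combine (quotient {L} 4 x) _  ≡⟨ cong (λ i → combine {L} i _) (splitAt⁻¹-↑ˡ split) ⟨
        combine (y ↑ˡ r) _            ≡⟨ cong (λ y → combine {L} (y ↑ˡ r) _) (combine-remQuot {M} (suc d) y) ⟨
        vertex (quotient {M} (suc d) y) (proj₂ (remQuot {M} (suc d) y)) (proj₂ (remQuot {L} 4 x)) ∎)
      where open ≡-Reasoning

    open Hubs digraph colour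

    nonempty : Fin (suc d) → HubsNonempty
    nonempty j v = vertex v j 0F , colour-vertex v j 0F

    -- The arcs of `ρ` join the paths 0F, 1F, 2F, 3F of the slots of a hub into one directed cycle
    -- through all its vertices, and membership in `S` spreads along that cycle.
    connected : HubsConnected
    connected v S closed {x} {y} col-x col-y x∈S
      with j , p , refl ← coloured {x} col-x
      with j′ , p′ , refl ← coloured {y} col-y
      = descend j′ p′ (rotate-transitive (λ j → vertex v j 0F ∈ S) (λ j → rise j 0F) (rise j p x∈S) j′)
      where
      follow : ∀ {j p j′ p′} → vertex v j p ⟶ vertex v j′ p′ → vertex v j p ∈ S → vertex v j′ p′ ∈ S
      follow {j′ = j′} {p′} x⟶y x∈ = closed x∈ x⟶y (colour-vertex v j′ p′)

      ρ-slot : ∀ j → ρ ⟨$⟩ʳ (combine v j ↑ˡ r) ≡ combine v (rotate d ⟨$⟩ʳ j) ↑ˡ r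
      ρ-slot j = trans (extend-↑ˡ r (inBlocks M (rotate d)) (combine v j)) (cong (_↑ˡ r) (inBlocks-combine M (rotate d) v j))

      0⟶1 : ∀ j → vertex v j 0F ∈ S → vertex v j 1F ∈ S
      0⟶1 j = follow {j} {0F} {j} {1F} (arc (here refl))
      1⟶2 : ∀ j → vertex v j 1F ∈ S → vertex v j 2F ∈ S
      1⟶2 j = follow {j} {1F} {j} {2F} (arc (here refl))
      2⟶3 : ∀ j → vertex v j 2F ∈ S → vertex v j 3F ∈ S
      2⟶3 j = follow {j} {2F} {j} {3F} (arc (here refl))
      3⟶0 : ∀ j → vertex v j 3F ∈ S → vertex v (rotate d ⟨$⟩ʳ j) 0F ∈ S
      3⟶0 j = follow {j} {3F} {rotate d ⟨$⟩ʳ j} {0F} (arc (there (here (cong (_, 0F) (sym (ρ-slot j))))))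

      descend : ∀ j p → vertex v j 0F ∈ S → vertex v j p ∈ S
      descend j 0F = λ x∈ → x∈
      descend j 1F = 0⟶1 j
      descend j 2F = 1⟶2 j ∘ 0⟶1 j
      descend j 3F = 2⟶3 j ∘ 1⟶2 j ∘ 0⟶1 j

      rise : ∀ j p → vertex v j p ∈ S → vertex v (rotate d ⟨$⟩ʳ j) 0F ∈ S
      rise j 0F = 3⟶0 j ∘ 2⟶3 j ∘ 1⟶2 j ∘ 0⟶1 j
      rise j 1F = 3⟶0 j ∘ 2⟶3 j ∘ 1⟶2 j
      rise j 2F = 3⟶0 j ∘ 2⟶3 j
      rise j 3F = 3⟶0 j

    hubs-expanding : ∀ {s} → Expanding s M (suc d) π → HubsExpanding s
    hubs-expanding expanding A B s≤A s≤B
      with a , i , b , j , a∈A , b∈B , eq ← expanding A B s≤A s≤B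
      = vertex a i 1F , vertex b j 0F , a , b ,
        arc (there (here (cong (_, 0F) (sym (trans (extend-↑ˡ r π (combine a i)) (cong (_↑ˡ r) eq)))))) ,
        colour-vertex a i 1F , colour-vertex b j 0F , a∈A , b∈B

  -- Here `q * 2` is n. The two bounds by n make `D * k` and `D` each at most q / 2: one half pays
  -- for the cops, the other for the remainder `r`. If `s ≤ 3 * k`, then `r + s * D` would stay
  -- below `3 * (D * k + D)`, hence below `3 * q`.
  few-cops : ∀ D k q s {r} → 4 * D * k ≤ q * 2 → 4 * D ≤ q * 2 → r < D →
             3 * q ≡ r + s * D → 3 * k < s
  few-cops D k q s {r} k≤ q≥ r<D split = ≰⇒> λ s≤3k → <-irrefl refl (begin-strict
    3 * q                  ≡⟨ split ⟩
    r + s * D              <⟨ +-mono-<-≤ r<D (*-monoˡ-≤ D s≤3k) ⟩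
    D + 3 * k * D          ≤⟨ m≤m+n _ (2 * D) ⟩
    D + 3 * k * D + 2 * D  ≡⟨ collect D k ⟩
    3 * (D * k + D)        ≤⟨ *-monoʳ-≤ 3 Dk+D≤q ⟩
    3 * q                  ∎)
    where
    open ≤-Reasoning
    collect : ∀ D k → D + 3 * k * D + 2 * D ≡ 3 * (D * k + D)
    collect = solve-∀
    expand : ∀ D k → 4 * (D * k + D) ≡ 4 * D * k + 4 * D
    expand = solve-∀
    quadruple : ∀ q → q * 2 + q * 2 ≡ 4 * q
    quadruple = solve-∀
    Dk+D≤q : D * k + D ≤ q
    Dk+D≤q = *-cancelˡ-≤ 4 (begin
      4 * (D * k + D)    ≡⟨ expand D k ⟩
      4 * D * k + 4 * D  ≤⟨ +-mono-≤ k≤ q≥ ⟩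
      q * 2 + q * 2      ≡⟨ quadruple q ⟩
      4 * q              ∎)

  evasive-graph : ∀ s d r → 0 < s → ∃[ π ] Expanding s (s * 4) (suc d) π →
                  ∃[ G ] Regular {(s * 4 * suc d + r) * 4} 3 G ×
                    (∀ k → 3 * k < s → ¬ CopsCatch G k)
  evasive-graph s d r 0<s (π , expanding) =
    digraph , cubic , λ k 3k<s →
      robber-wins connected (hubs-expanding expanding) (nonempty zero) 0<s (count 3k<s)
    where
    open HubGraph (s * 4) d r π
    open Hubs digraph colour
    count : ∀ {k} → 3 * k < s → 3 * (s + k) < s * 4
    count {k} 3k<s = begin-strict
      3 * (s + k)    ≡⟨ *-distribˡ-+ 3 s k ⟩
      3 * s + 3 * k  <⟨ +-monoʳ-< (3 * s) 3k<s ⟩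
      3 * s + s      ≡⟨ +-comm (3 * s) s ⟩
      4 * s          ≡⟨ *-comm 4 s ⟩
      s * 4          ∎
      where open ≤-Reasoning

-- The rational bound and the choice of parameters

open import Data.Integer using (+_)
open import Data.Rational using (ℚ; 0ℚ; _/_; _*_; _≤_; _<_; toℚᵘ)
import Data.Integer as ℤ
import Data.Integer.Properties as ℤ
import Data.Nat as ℕ
import Data.Nat.DivMod as ℕ
import Data.Nat.Properties as ℕ
import Data.Rational.Properties as ℚ
import Data.Rational.Unnormalised as ℚᵘ
import Data.Rational.Unnormalised.Properties as ℚᵘ

α₀ : ℚ
α₀ = + 1 / 320

-- The fraction `+ k / 1` is normalised by a gcd that is stuck for a variable `k`; as an
-- unnormalised rational it has explicit numerator and denominator, and cross-multiplication gives
-- the integer inequality.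
≤α₀n : ∀ k n → (+ k / 1) ≤ α₀ * (+ n / 1) → 320 *ℕ k ℕ.≤ n
≤α₀n k n le = drop (begin
  ℚᵘ.mkℚᵘ (+ k) 0              ≃⟨ ℚ.toℚᵘ-fromℚᵘ (ℚᵘ.mkℚᵘ (+ k) 0) ⟨
  toℚᵘ (+ k / 1)               ≤⟨ ℚ.toℚᵘ-mono-≤ le ⟩
  toℚᵘ (α₀ * (+ n / 1))        ≃⟨ ℚ.toℚᵘ-homo-* α₀ (+ n / 1) ⟩
  toℚᵘ α₀ ℚᵘ.* toℚᵘ (+ n / 1)  ≃⟨ ℚᵘ.*-congˡ {toℚᵘ α₀} (ℚ.toℚᵘ-fromℚᵘ (ℚᵘ.mkℚᵘ (+ n) 0)) ⟩
  toℚᵘ α₀ ℚᵘ.* ℚᵘ.mkℚᵘ (+ n) 0 ∎)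
  where
  open ℚᵘ.≤-Reasoning
  drop : ℚᵘ.mkℚᵘ (+ k) 0 ℚᵘ.≤ toℚᵘ α₀ ℚᵘ.* ℚᵘ.mkℚᵘ (+ n) 0 → 320 *ℕ k ℕ.≤ n
  drop (ℚᵘ.*≤* k≤n) = ℤ.drop‿+≤+ (subst₂ ℤ._≤_
    (trans (sym (ℤ.pos-* k 320)) (cong +_ (ℕ.*-comm k 320)))
    (trans (ℤ.*-identityʳ _) (ℤ.*-identityˡ (+ n))) k≤n)

corollary3 : ∃[ α ] 0ℚ < α × ∃[ n₀ ] (∀ n → n ≥ n₀ → 2 ∣ n →
    ∃[ G ] Regular {6 *ℕ n} 3 G ×
    (∀ k → (+ k / 1) ≤ α * (+ n / 1) → ¬ CopsCatch G k))
corollary3 = α₀ , ℚ.positive⁻¹ α₀ , 320 , λ { _ n≥320 (divides q refl) → graph q n≥320 }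
  where
  Robust : ℕ → ℕ → Set
  Robust n m = ∃[ G ] Regular {m} 3 G × (∀ k → (+ k / 1) ≤ α₀ * (+ n / 1) → ¬ CopsCatch G k)

  -- n = 2 q needs 3 q slots, 80 for each unit of s and fewer than 80 outside the
  -- hubs; 20 is large enough for 4 ^ 4 * 3 ^ 20 < 4 ^ 20.
  graph : ∀ q → q *ℕ 2 ≥ 320 → Robust (q *ℕ 2) (6 *ℕ (q *ℕ 2))
  graph q n≥320 = subst (Robust (q *ℕ 2)) size (robust (Graph.evasive-graph s 19 r (enough 0 ℕ.z≤n)
    (Counting.expanding-permutation 20 s (ℕ.<ᵇ⇒< (4 ℕ.^ 4 *ℕ 3 ℕ.^ 20) (4 ℕ.^ 20) _) (enough 0 ℕ.z≤n))))
    where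
    s = 3 *ℕ q ℕ./ 80
    r = 3 *ℕ q ℕ.% 80
    split : 3 *ℕ q ≡ r ℕ.+ s *ℕ 80
    split = ℕ.m≡m%n+[m/n]*n (3 *ℕ q) 80
    -- At `k = 0` this says that `s` is positive; `n ≥ 320` is what guarantees it.
    enough : ∀ k → 320 *ℕ k ℕ.≤ q *ℕ 2 → 3 *ℕ k ℕ.< s
    enough k k≤ = Graph.few-cops 80 k q s k≤ n≥320 (ℕ.m%n<n (3 *ℕ q) 80) split
    robust : ∀ {m} → ∃[ G ] Regular {m} 3 G × (∀ k → 3 *ℕ k ℕ.< s → ¬ CopsCatch G k) → Robust (q *ℕ 2) m
    robust (G , cubic , wins) = G , cubic , λ k k≤αn → wins k (enough k (≤α₀n k (q *ℕ 2) k≤αn))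
    size : (s *ℕ 4 *ℕ 20 ℕ.+ r) *ℕ 4 ≡ 6 *ℕ (q *ℕ 2)
    size = trans (cong (_*ℕ 4) (trans (regroup s r) (sym split))) (twelve q)
      where
      regroup : ∀ s r → s *ℕ 4 *ℕ 20 ℕ.+ r ≡ r ℕ.+ s *ℕ 80
      regroup = solve-∀
      twelve : ∀ q → 3 *ℕ q *ℕ 4 ≡ 6 *ℕ (q *ℕ 2)
      twelve = solve-∀
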